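{- Let $\Sigma=\{a,b\}$ and let $h:\Sigma^*\to\Sigma^*$ be the morphism given by $h(a)=aaaab$ and $h(b)=ababab$. Then the fixed point $h^\omega(a)$ is abelian $5$-power free and does not contain the factor $bb$. However, for every $k\ge 2$, the morphism $h$ is not abelian $k$-power free.
   Context: $\Sigma^*$ is the free monoid of finite words over $\Sigma$, with empty word $\epsilon$; a morphism is a monoid homomorphism. Since $h(a)$ begins with $a$ and has length greater than $1$, each $h^n(a)$ is a proper prefix of $h^{n+1}(a)$, and $h^\omega(a)$ denotes the infinite word having every $h^n(a)$ as a prefix (a fixed point of $h$). A factor of a word is a contiguous finite subword. The Parikh vector $\psi(u)$ of a finite word $u$ records the number of occurrences of each letter in $u$. A word $u$ (finite or infinite) is abelian $k$-power free if whenever $u=xv_1\cdots v_ky$ with $\psi(v_1)=\cdots=\psi(v_k)$, one has $v_1=\cdots=v_k=\epsilon$. A morphism $h$ is abelian $k$-power free if $h(u)$ is abelian $k$-power free for every abelian $k$-power free word $u$. -}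

module Defs where

open import Data.Nat using (ℕ; zero; suc; _+_; _≤_; _<_; z≤n; s≤s)
open import Data.Nat.Properties using (+-suc; ≤-trans; ≤-total; m≤n+m; m≤n⇒∃[o]m+o≡n; +-mono-≤; +-comm)
open import Data.Fin using (Fin; zero; suc; fromℕ<)
open import Data.List using (List; []; _∷_; [_]; _++_; length; lookup; concat; concatMap; filter)
open import Data.List.Properties using (concatMap-++; ++-assoc; ++-identityʳ)
open import Data.Vec using (Vec; []; _∷_; toList)
import Data.Vec as Vec
open import Data.Product using (∃-syntax; _,_)
open import Data.Sum using (inj₁; inj₂)
open import Relation.Nullary using (yes; no)
open import Relation.Binary.Definitions using (DecidableEquality)
open import Relation.Binary.PropositionalEquality
  using (_≡_; _≗_; refl; sym; trans; cong; subst)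

data Letter : Set where
  a b : Letter

_≟_ : DecidableEquality Letter
a ≟ a = yes refl
a ≟ b = no λ ()
b ≟ a = no λ ()
b ≟ b = yes refl

Word : Set
Word = List Letter

ωWord : Set
ωWord = ℕ → Letter

infixr 5 _·_

_·_ : Word → ωWord → ωWord
([]      · w) i       = w i
((c ∷ u) · w) zero    = c
((c ∷ u) · w) (suc i) = (u · w) i

_PrefixOf_ : Word → ωWord → Set
u PrefixOf w = ∃[ y ] w ≗ u · y

_FactorOf_ : Word → ωWord → Set
u FactorOf w = ∃[ x ] ∃[ y ] w ≗ (x ++ u) · y

occurrences : Letter → Word → ℕ
occurrences c u = length (filter (c ≟_) u)

ψ : Word → Vec ℕ 2
ψ u = occurrences a u ∷ occurrences b u ∷ []

AbelianEqual : ∀ {k} → Vec Word k → Set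
AbelianEqual vs = ∀ i j → ψ (Vec.lookup vs i) ≡ ψ (Vec.lookup vs j)

AllEmpty : ∀ {k} → Vec Word k → Set
AllEmpty vs = ∀ i → Vec.lookup vs i ≡ []

AbelianPowerFree : ℕ → Word → Set
AbelianPowerFree k u =
  ∀ (x : Word) (vs : Vec Word k) (y : Word) →
  u ≡ x ++ concat (toList vs) ++ y → AbelianEqual vs → AllEmpty vs

-- In a factorisation x v₁ ⋯ vₖ y of an infinite word, y is the infinite tail.
AbelianPowerFreeω : ℕ → ωWord → Set
AbelianPowerFreeω k w =
  ∀ (x : Word) (vs : Vec Word k) (y : ωWord) →
  w ≗ (x ++ concat (toList vs)) · y → AbelianEqual vs → AllEmpty vs

AbelianPowerFreeMorphism : ℕ → (Word → Word) → Set
AbelianPowerFreeMorphism k f = ∀ u → AbelianPowerFree k u → AbelianPowerFree k (f u)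

hLetter : Letter → Word
hLetter a = a ∷ a ∷ a ∷ a ∷ b ∷ []
hLetter b = a ∷ b ∷ a ∷ b ∷ a ∷ b ∷ []

-- Extending a map on letters by concatMap gives the unique monoid
-- homomorphism with these values; see concatMap-++.
h : Word → Word
h = concatMap hLetter

h^ : ℕ → Word → Word
h^ zero    u = u
h^ (suc n) u = h (h^ n u)

length-h : ∀ u → length u + length u ≤ length (h u)
length-h []      = z≤n
length-h (a ∷ u) rewrite +-suc (length u) (length u) =
  s≤s (s≤s (≤-trans (length-h u) (m≤n+m _ 3)))
length-h (b ∷ u) rewrite +-suc (length u) (length u) =
  s≤s (s≤s (≤-trans (length-h u) (m≤n+m _ 4)))

n<length-h^ : ∀ n → n < length (h^ n [ a ])
n<length-h^ zero    = s≤s z≤n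
n<length-h^ (suc n) =
  ≤-trans (+-mono-≤ (≤-trans (s≤s z≤n) (n<length-h^ n)) (n<length-h^ n))
          (length-h (h^ n [ a ]))

-- The i-th letter (from 0) of h^ω(a), read off from hⁱ(a), which is longer
-- than i.  By hω-prefix below, hω is the infinite word with all hⁿ(a) as prefixes.
hω : ωWord
hω i = lookup (h^ i [ a ]) (fromℕ< (n<length-h^ i))

h^-step : ∀ n → ∃[ t ] h^ (suc n) [ a ] ≡ h^ n [ a ] ++ t
h^-step zero = _ , refl
h^-step (suc n) with h^-step n
... | t , eq = h t , trans (cong h eq) (concatMap-++ hLetter (h^ n [ a ]) t)

h^-extend : ∀ n m → ∃[ t ] h^ (m + n) [ a ] ≡ h^ n [ a ] ++ t
h^-extend n zero = [] , sym (++-identityʳ _)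
h^-extend n (suc m) with h^-extend n m | h^-step (m + n)
... | t , eq | s , eq′ =
  t ++ s , trans eq′ (trans (cong (_++ s) eq) (++-assoc (h^ n [ a ]) t s))

lookup-prefix : ∀ (u t : Word) {v} → v ≡ u ++ t →
  ∀ i (p : i < length u) (q : i < length v) →
  lookup v (fromℕ< q) ≡ lookup u (fromℕ< p)
lookup-prefix (c ∷ u) t refl zero    p       q       = refl
lookup-prefix (c ∷ u) t refl (suc i) (s≤s p) (s≤s q) = lookup-prefix u t refl i p q

prefix-from-lookup : ∀ (u : Word) (w : ωWord) →
  (∀ i (p : i < length u) → w i ≡ lookup u (fromℕ< p)) → u PrefixOf w
prefix-from-lookup []      w eq = w , λ _ → refl
prefix-from-lookup (c ∷ u) w eq
  with prefix-from-lookup u (λ i → w (suc i)) (λ i p → eq (suc i) (s≤s p))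
... | y , eqs = y , λ { zero → eq zero (s≤s z≤n) ; (suc i) → eqs i }

hω-prefix : ∀ n → h^ n [ a ] PrefixOf hω
hω-prefix n = prefix-from-lookup (h^ n [ a ]) hω agree
  where
  agree : ∀ i (p : i < length (h^ n [ a ])) → hω i ≡ lookup (h^ n [ a ]) (fromℕ< p)
  agree i p with ≤-total i n
  ... | inj₁ i≤n with m≤n⇒∃[o]m+o≡n i≤n
  ...   | o , refl rewrite +-comm i o with h^-extend i o
  ...     | t , eq = sym (lookup-prefix (h^ i [ a ]) t eq i (n<length-h^ i) p)
  agree i p | inj₂ n≤i with m≤n⇒∃[o]m+o≡n n≤i
  ...   | o , refl with h^-extend n o
  ...     | t , eq = lookup-prefix (h^ n [ a ]) t (trans (cong (λ m → h^ m [ a ]) (+-comm n o)) eq) (n + o) p (n<length-h^ (n + o))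

{-# OPTIONS --safe #-}
-- Modulo 9, the weight #a + 5 #b vanishes on h(a) and h(b), so the residue of a
-- prefix p of h^ω(a) depends only on where p ends inside a block; it is never 5
-- or 8, and p is h of a shorter prefix (its root) up to a correction determined
-- by the residue.  The six boundaries of an abelian 5th power have residues in
-- arithmetic progression.  If these are equal, the roots bound a smaller abelian
-- 5th power.  Avoiding 5 and 8 otherwise forces the difference 3 or 6, and then
-- two boundaries three steps apart both have residue 6 or both 7, so they lie inside
-- h(b) and their roots are followed by b.  But #a + 2 #b ≡ 1 (mod 3) at every
-- position followed by b, which makes the difference of the residues 0.
-- The same congruence excludes bb, since it cannot hold before and after a b.
-- For the morphism, b^(k-1) is abelian k-power free and h(b^(k-1)) = (ab)^(3k-3).
module Submission where

open import Defs
open import Data.Nat using (ℕ; _≤_)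
open import Data.List using ([]; _∷_)
open import Data.Product using (_×_)
open import Relation.Nullary using (¬_)
open import Data.Nat using (zero; suc; _+_; _*_; _<_; _%_; _/_; z≤n; s≤s)
import Data.Nat as ℕ
open import Data.Nat.Properties hiding (_≟_)
open import Data.Nat.DivMod
open import Data.Nat.Tactic.RingSolver using (solve-∀)
open import Data.Fin using (Fin; suc; inject₁; toℕ; fromℕ<)
open import Data.Fin.Patterns
open import Data.Fin.Properties using (all?; toℕ-fromℕ<)
open import Data.List using ([_]; _++_; length; concat; filter; replicate)
open import Data.List.Properties
open import Data.Vec using (Vec; []; _∷_; toList)
import Data.Vec as Vec
import Data.Vec.Properties as Vec
open import Data.Product using (∃-syntax; _,_)
open import Data.Sum using (_⊎_; inj₁; inj₂)
open import Relation.Nullary.Negation using (contradiction)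
open import Relation.Nullary.Decidable using (Dec; from-yes; _→-dec_; _×-dec_; _⊎-dec_; ¬?)
open import Relation.Binary.PropositionalEquality hiding ([_])
open ≡-Reasoning

-- Letter counts under `h`, and a weight modulo 9.

occurrences-++ : ∀ c u v → occurrences c (u ++ v) ≡ occurrences c u + occurrences c v
occurrences-++ c u v =
  trans (cong length (filter-++ (c ≟_) u v)) (length-++ (filter (c ≟_) u))

length-occurrences : ∀ u → length u ≡ occurrences a u + occurrences b u
length-occurrences []      = refl
length-occurrences (a ∷ u) = cong suc (length-occurrences u)
length-occurrences (b ∷ u) = trans (cong suc (length-occurrences u)) (sym (+-suc _ _))

occurrences-h-a : ∀ u → occurrences a (h u) ≡ 4 * occurrences a u + 3 * occurrences b u
occurrences-h-a []      = refl
occurrences-h-a (a ∷ u) rewrite occurrences-h-a u = lemma (occurrences a u) (occurrences b u)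
  where lemma : ∀ m n → 4 + (4 * m + 3 * n) ≡ 4 * (1 + m) + 3 * n
        lemma = solve-∀
occurrences-h-a (b ∷ u) rewrite occurrences-h-a u = lemma (occurrences a u) (occurrences b u)
  where lemma : ∀ m n → 3 + (4 * m + 3 * n) ≡ 4 * m + 3 * (1 + n)
        lemma = solve-∀

occurrences-h-b : ∀ u → occurrences b (h u) ≡ occurrences a u + 3 * occurrences b u
occurrences-h-b []      = refl
occurrences-h-b (a ∷ u) rewrite occurrences-h-b u = refl
occurrences-h-b (b ∷ u) rewrite occurrences-h-b u = lemma (occurrences a u) (occurrences b u)
  where lemma : ∀ m n → 3 + (m + 3 * n) ≡ m + 3 * (1 + n)
        lemma = solve-∀

weight : ℕ → Word → ℕ
weight k u = occurrences a u + k * occurrences b u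

weight-++ : ∀ k u v → weight k (u ++ v) ≡ weight k u + weight k v
weight-++ k u v rewrite occurrences-++ a u v | occurrences-++ b u v =
  lemma k (occurrences a u) (occurrences a v) (occurrences b u) (occurrences b v)
  where lemma : ∀ k m m′ n n′ → (m + m′) + k * (n + n′) ≡ (m + k * n) + (m′ + k * n′)
        lemma = solve-∀

-- `h a` has weight 4 + 5 = 9 and `h b` has weight 3 + 15 = 18. Dividing by 9 thus turns coefficient
-- 5 on the image into coefficient 2 on the preimage.
weight-h : ∀ u → weight 5 (h u) ≡ weight 2 u * 9
weight-h u rewrite occurrences-h-a u | occurrences-h-b u =
  lemma (occurrences a u) (occurrences b u)
  where lemma : ∀ m n → (4 * m + 3 * n) + 5 * (m + 3 * n) ≡ (m + 2 * n) * 9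
        lemma = solve-∀

residue : Word → ℕ
residue u = weight 5 u % 9

residue-h-++ : ∀ u v → residue (h u ++ v) ≡ residue v
residue-h-++ u v = begin
  weight 5 (h u ++ v) % 9          ≡⟨ cong (_% 9) (weight-++ 5 (h u) v) ⟩
  (weight 5 (h u) + weight 5 v) % 9 ≡⟨ cong (λ n → (n + weight 5 v) % 9) (weight-h u) ⟩
  (weight 2 u * 9 + weight 5 v) % 9 ≡⟨ cong (_% 9) (+-comm (weight 2 u * 9) (weight 5 v)) ⟩
  (weight 5 v + weight 2 u * 9) % 9 ≡⟨ [m+kn]%n≡m%n (weight 5 v) (weight 2 u) 9 ⟩
  weight 5 v % 9                   ∎

-- Cutting a prefix of an image back to a root.

-- Both corrections depend on the residue alone, so boundaries of equal residue receive the same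
-- corrections, which later cancel. Residue 1 also occurs in both blocks, but the part already read
-- is `a` in either case. The defaults include 5 and 8, which never occur.
completion remainder : ℕ → Word
completion 3 = a ∷ b ∷ []
completion 4 = b ∷ []
completion _ = []
remainder 1 = a ∷ []
remainder 2 = a ∷ a ∷ []
remainder 6 = a ∷ b ∷ []
remainder 7 = a ∷ b ∷ a ∷ []
remainder _ = []

-- Successive cuts of `h a` have residues 0, 1, 2, 3, 4 and those of `h b` have 0, 1, 6, 7, 3, 4. So
-- 5 and 8 are missed, and 6 and 7 identify the block as `h b`.
Attained InsideB : ℕ → Set
Attained r = ¬ r ≡ 5 × ¬ r ≡ 8
InsideB r = r ≡ 6 ⊎ r ≡ 7

-- Residues 3 and 4 occur inside both h a and h b, but there the rest of the
-- block is the same for both letters, so p is completed instead of cut.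
record Desubstitution (w p : Word) : Set where
  field
    root rest  : Word
    split      : w ≡ root ++ rest
    aligned    : p ++ completion (residue p) ≡ h root ++ remainder (residue p)
    attained   : Attained (residue p)
    followed-b : InsideB (residue p) → ∃[ t ] rest ≡ b ∷ t

-- A whole block weighs 0 modulo 9, so prepending it changes neither the residue nor the
-- corrections.
cons-Desubstitution : ∀ c {w p} → Desubstitution w p → Desubstitution (c ∷ w) (h [ c ] ++ p)
cons-Desubstitution c {w} {p} d = record
  { root       = c ∷ D.root
  ; rest       = D.rest
  ; split      = cong (c ∷_) D.split
  ; aligned    = begin
      (h [ c ] ++ p) ++ completion (residue (h [ c ] ++ p))
        ≡⟨ cong (λ r → (h [ c ] ++ p) ++ completion r) same ⟩
      (h [ c ] ++ p) ++ completion (residue p)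
        ≡⟨ ++-assoc (h [ c ]) p _ ⟩
      h [ c ] ++ p ++ completion (residue p)
        ≡⟨ cong (h [ c ] ++_) D.aligned ⟩
      h [ c ] ++ h D.root ++ remainder (residue p)
        ≡⟨ ++-assoc (h [ c ]) (h D.root) _ ⟨
      (h [ c ] ++ h D.root) ++ remainder (residue p)
        ≡⟨ cong₂ (λ u r → u ++ remainder r) (sym (concatMap-++ hLetter [ c ] D.root)) (sym same) ⟩
      h (c ∷ D.root) ++ remainder (residue (h [ c ] ++ p)) ∎
  ; attained   = subst Attained (sym same) D.attained
  ; followed-b = λ i → D.followed-b (subst InsideB same i)
  }
  where
  module D = Desubstitution d
  same : residue (h [ c ] ++ p) ≡ residue p
  same = residue-h-++ [ c ] p

-- Whole blocks are peeled off until `p` ends inside the first one; the other clauses list the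
-- possible cuts.
desubstitute : ∀ w p t → h w ≡ p ++ t → Desubstitution w p
desubstitute w [] t e = record
  { root = [] ; rest = w ; split = refl ; aligned = refl
  ; attained = (λ ()) , (λ ()) ; followed-b = λ { (inj₁ ()) ; (inj₂ ()) } }
desubstitute (a ∷ w) (_ ∷ []) t refl = record
  { root = [] ; rest = a ∷ w ; split = refl ; aligned = refl
  ; attained = (λ ()) , (λ ()) ; followed-b = λ { (inj₁ ()) ; (inj₂ ()) } }
desubstitute (a ∷ w) (_ ∷ _ ∷ []) t refl = record
  { root = [] ; rest = a ∷ w ; split = refl ; aligned = refl
  ; attained = (λ ()) , (λ ()) ; followed-b = λ { (inj₁ ()) ; (inj₂ ()) } }
-- From residue 3 on, the block is completed, so its letter already belongs to the root.
desubstitute (a ∷ w) (_ ∷ _ ∷ _ ∷ []) t refl = record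
  { root = a ∷ [] ; rest = w ; split = refl ; aligned = refl
  ; attained = (λ ()) , (λ ()) ; followed-b = λ { (inj₁ ()) ; (inj₂ ()) } }
desubstitute (a ∷ w) (_ ∷ _ ∷ _ ∷ _ ∷ []) t refl = record
  { root = a ∷ [] ; rest = w ; split = refl ; aligned = refl
  ; attained = (λ ()) , (λ ()) ; followed-b = λ { (inj₁ ()) ; (inj₂ ()) } }
desubstitute (a ∷ w) (a ∷ a ∷ a ∷ a ∷ b ∷ p) t e =
  cons-Desubstitution a (desubstitute w p t (++-cancelˡ (h [ a ]) (h w) (p ++ t) e))
desubstitute (b ∷ w) (_ ∷ []) t refl = record
  { root = [] ; rest = b ∷ w ; split = refl ; aligned = refl
  ; attained = (λ ()) , (λ ()) ; followed-b = λ _ → w , refl }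
desubstitute (b ∷ w) (_ ∷ _ ∷ []) t refl = record
  { root = [] ; rest = b ∷ w ; split = refl ; aligned = refl
  ; attained = (λ ()) , (λ ()) ; followed-b = λ _ → w , refl }
desubstitute (b ∷ w) (_ ∷ _ ∷ _ ∷ []) t refl = record
  { root = [] ; rest = b ∷ w ; split = refl ; aligned = refl
  ; attained = (λ ()) , (λ ()) ; followed-b = λ _ → w , refl }
desubstitute (b ∷ w) (_ ∷ _ ∷ _ ∷ _ ∷ []) t refl = record
  { root = b ∷ [] ; rest = w ; split = refl ; aligned = refl
  ; attained = (λ ()) , (λ ()) ; followed-b = λ { (inj₁ ()) ; (inj₂ ()) } }
desubstitute (b ∷ w) (_ ∷ _ ∷ _ ∷ _ ∷ _ ∷ []) t refl = record
  { root = b ∷ [] ; rest = w ; split = refl ; aligned = refl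
  ; attained = (λ ()) , (λ ()) ; followed-b = λ { (inj₁ ()) ; (inj₂ ()) } }
desubstitute (b ∷ w) (a ∷ b ∷ a ∷ b ∷ a ∷ b ∷ p) t e =
  cons-Desubstitution b (desubstitute w p t (++-cancelˡ (h [ b ]) (h w) (p ++ t) e))

-- A congruence modulo 3 in front of every `b`.

weight-h-++-%3 : ∀ c u → weight 2 (h [ c ] ++ u) % 3 ≡ weight 2 u % 3
weight-h-++-%3 c u = begin
  weight 2 (h [ c ] ++ u) % 3             ≡⟨ cong (_% 3) (weight-++ 2 (h [ c ]) u) ⟩
  (weight 2 (h [ c ]) + weight 2 u) % 3   ≡⟨ cong (_% 3) (+-comm (weight 2 (h [ c ])) (weight 2 u)) ⟩
  (weight 2 u + weight 2 (h [ c ])) % 3   ≡⟨ cong (λ n → (weight 2 u + n) % 3) (multiple c) ⟩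
  (weight 2 u + quot c * 3) % 3           ≡⟨ [m+kn]%n≡m%n (weight 2 u) (quot c) 3 ⟩
  weight 2 u % 3                          ∎
  where
  quot : Letter → ℕ
  quot a = 2
  quot b = 3
  multiple : ∀ c → weight 2 (h [ c ]) ≡ quot c * 3
  multiple a = refl
  multiple b = refl

-- Within its block a `b` is preceded by `aaaa`, `a`, `aba` or `ababa`, of weights 4, 1, 4 and 7,
-- all 1 modulo 3. The earlier blocks weigh 6 or 9 each.
before-b : ∀ w p t → h w ≡ p ++ b ∷ t → weight 2 p % 3 ≡ 1
before-b []      []      t ()
before-b []      (_ ∷ _) t ()
before-b (a ∷ w) []      t ()
before-b (b ∷ w) []      t ()
before-b (a ∷ w) (a ∷ a ∷ a ∷ a ∷ []) t e = refl
before-b (a ∷ w) (a ∷ a ∷ a ∷ a ∷ b ∷ p) t e =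
  trans (weight-h-++-%3 a p)
        (before-b w p t (++-cancelˡ (h [ a ]) (h w) (p ++ b ∷ t) e))
before-b (b ∷ w) (a ∷ []) t e = refl
before-b (b ∷ w) (a ∷ b ∷ a ∷ []) t e = refl
before-b (b ∷ w) (a ∷ b ∷ a ∷ b ∷ a ∷ []) t e = refl
before-b (b ∷ w) (a ∷ b ∷ a ∷ b ∷ a ∷ b ∷ p) t e =
  trans (weight-h-++-%3 b p)
        (before-b w p t (++-cancelˡ (h [ b ]) (h w) (p ++ b ∷ t) e))

-- Prefixes of `hω`, and the absence of `bb`.

++-· : ∀ u v w → (u ++ v) · w ≗ u · (v · w)
++-· []      v w i       = refl
++-· (c ∷ u) v w zero    = refl
++-· (c ∷ u) v w (suc i) = ++-· u v w i

prefix-++ˡ : ∀ u v {w} → (u ++ v) PrefixOf w → u PrefixOf w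
prefix-++ˡ u v (y , eq) = v · y , λ i → trans (eq i) (++-· u v y i)

compare-prefixes : ∀ u v {w} → u PrefixOf w → v PrefixOf w →
  (∃[ t ] v ≡ u ++ t) ⊎ (∃[ t ] u ≡ v ++ t)
compare-prefixes []      v       _ _ = inj₁ (v , refl)
compare-prefixes (c ∷ u) []      _ _ = inj₂ (c ∷ u , refl)
compare-prefixes (c ∷ u) (d ∷ v) {w} (y , eq) (z , eq′)
  with trans (sym (eq 0)) (eq′ 0)
... | refl with compare-prefixes u v {λ i → w (suc i)} (y , λ i → eq (suc i)) (z , λ i → eq′ (suc i))
...   | inj₁ (t , e) = inj₁ (t , cong (c ∷_) e)
...   | inj₂ (t , e) = inj₂ (t , cong (c ∷_) e)

-- The power `suc (length p)` of `h` is long enough to contain `p`, and being a successor it leaves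
-- an outermost `h` to strip.
prefix-of-image : ∀ p → p PrefixOf hω → ∃[ w ] (w PrefixOf hω × ∃[ t ] h w ≡ p ++ t)
prefix-of-image p pre with compare-prefixes p (h^ (suc (length p)) [ a ]) pre (hω-prefix (suc (length p)))
... | inj₁ (t , e) = h^ (length p) [ a ] , hω-prefix (length p) , t , e
... | inj₂ (t , e) = contradiction
  (≤-trans (length-++-≤ˡ (h^ (suc (length p)) [ a ])) (≤-reflexive (cong length (sym e))))
  (<⇒≱ (<⇒≤ (n<length-h^ (suc (length p)))))

prefix-before-b : ∀ p → (p ++ [ b ]) PrefixOf hω → weight 2 p % 3 ≡ 1
prefix-before-b p pre with prefix-of-image (p ++ [ b ]) pre
... | w , _ , t , e = before-b w p t (trans e (++-assoc p [ b ] t))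

no-bb : ¬ ((b ∷ b ∷ []) FactorOf hω)
no-bb (x , y , eq) = contradiction xb%3≡1 xb%3≢1
  where
  xbb : ((x ++ [ b ]) ++ [ b ]) PrefixOf hω
  xbb = subst (_PrefixOf hω) (sym (++-assoc x [ b ] [ b ])) (y , eq)
  x%3≡1 : weight 2 x % 3 ≡ 1
  x%3≡1 = prefix-before-b x (prefix-++ˡ (x ++ [ b ]) [ b ] xbb)
  xb%3≡1 : weight 2 (x ++ [ b ]) % 3 ≡ 1
  xb%3≡1 = prefix-before-b (x ++ [ b ]) xbb
  xb%3≡0 : weight 2 (x ++ [ b ]) % 3 ≡ 0
  xb%3≡0 = begin
    weight 2 (x ++ [ b ]) % 3  ≡⟨ cong (_% 3) (weight-++ 2 x [ b ]) ⟩
    (weight 2 x + 2) % 3       ≡⟨ %-distribˡ-+ (weight 2 x) 2 3 ⟩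
    (weight 2 x % 3 + 2) % 3   ≡⟨ cong (λ n → (n + 2) % 3) x%3≡1 ⟩
    0                          ∎
  xb%3≢1 : ¬ weight 2 (x ++ [ b ]) % 3 ≡ 1
  xb%3≢1 e = contradiction (trans (sym xb%3≡0) e) λ ()

-- Roots of prefixes of `hω`.

record Root (p : Word) : Set where
  field
    root        : Word
    root-prefix : root PrefixOf hω
    aligned     : p ++ completion (residue p) ≡ h root ++ remainder (residue p)
    attained    : Attained (residue p)
    root-weight : InsideB (residue p) → weight 2 root % 3 ≡ 1

prefix-root : ∀ p → p PrefixOf hω → Root p
prefix-root p pre with prefix-of-image p pre
... | w , wpre , t , e with desubstitute w p t e
...   | d = record
  { root        = D.root
  ; root-prefix = prefix-++ˡ D.root D.rest (subst (_PrefixOf hω) D.split wpre)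
  ; aligned     = D.aligned
  ; attained    = D.attained
  -- Inside `h b` the root is followed by `b` in `w`, which is itself a prefix of `hω`; hence the
  -- congruence holds at the root.
  ; root-weight = λ i → prefix-before-b D.root (with-b (D.followed-b i))
  }
  where
  module D = Desubstitution d
  with-b : ∃[ t ] D.rest ≡ b ∷ t → (D.root ++ [ b ]) PrefixOf hω
  with-b (t , eq) = prefix-++ˡ (D.root ++ [ b ]) t (subst (_PrefixOf hω)
    (trans D.split (trans (cong (D.root ++_) eq) (sym (++-assoc D.root [ b ] t)))) wpre)

-- Parikh vectors in arithmetic progression.

-- Equality of the differences of consecutive Parikh vectors, written without subtraction and
-- without assuming that any of the words is a prefix of another.
Midpoint : Word → Word → Word → Set
Midpoint p q r = ∀ c → occurrences c p + occurrences c r ≡ 2 * occurrences c q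

midpoint-weight : ∀ k p q r → Midpoint p q r → weight k p + weight k r ≡ 2 * weight k q
midpoint-weight k p q r m = begin
  weight k p + weight k r
    ≡⟨ shuffle k (occurrences a p) (occurrences b p) (occurrences a r) (occurrences b r) ⟩
  (occurrences a p + occurrences a r) + k * (occurrences b p + occurrences b r)
    ≡⟨ cong₂ (λ x y → x + k * y) (m a) (m b) ⟩
  2 * occurrences a q + k * (2 * occurrences b q)
    ≡⟨ double k (occurrences a q) (occurrences b q) ⟩
  2 * weight k q ∎
  where
  shuffle : ∀ k x y x′ y′ → (x + k * y) + (x′ + k * y′) ≡ (x + x′) + k * (y + y′)
  shuffle = solve-∀
  double : ∀ k x y → 2 * x + k * (2 * y) ≡ 2 * (x + k * y)
  double = solve-∀

midpoint-++ : ∀ {p q r} s → Midpoint p q r → Midpoint (p ++ s) (q ++ s) (r ++ s)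
midpoint-++ {p} {q} {r} s m c
  rewrite occurrences-++ c p s | occurrences-++ c q s | occurrences-++ c r s = begin
  (P + S) + (R + S) ≡⟨ shuffle P R S ⟩
  (P + R) + 2 * S   ≡⟨ cong (_+ 2 * S) (m c) ⟩
  2 * Q + 2 * S     ≡⟨ *-distribˡ-+ 2 Q S ⟨
  2 * (Q + S)       ∎
  where
  P = occurrences c p
  Q = occurrences c q
  R = occurrences c r
  S = occurrences c s
  shuffle : ∀ P R S → (P + S) + (R + S) ≡ (P + R) + 2 * S
  shuffle = solve-∀

midpoint-cancel : ∀ {p q r} s → Midpoint (p ++ s) (q ++ s) (r ++ s) → Midpoint p q r
midpoint-cancel {p} {q} {r} s m c = +-cancelʳ-≡ (2 * S) (P + R) (2 * Q) (begin
  (P + R) + 2 * S   ≡⟨ shuffle P R S ⟩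
  (P + S) + (R + S) ≡⟨ cong₂ _+_ (occurrences-++ c p s) (occurrences-++ c r s) ⟨
  occurrences c (p ++ s) + occurrences c (r ++ s) ≡⟨ m c ⟩
  2 * occurrences c (q ++ s) ≡⟨ cong (2 *_) (occurrences-++ c q s) ⟩
  2 * (Q + S)       ≡⟨ *-distribˡ-+ 2 Q S ⟩
  2 * Q + 2 * S     ∎)
  where
  P = occurrences c p
  Q = occurrences c q
  R = occurrences c r
  S = occurrences c s
  shuffle : ∀ P R S → (P + R) + 2 * S ≡ (P + S) + (R + S)
  shuffle = solve-∀

-- Possible because the incidence matrix of h is invertible over ℚ.
midpoint-h⁻¹ : ∀ {p q r} → Midpoint (h p) (h q) (h r) → Midpoint p q r
midpoint-h⁻¹ {p} {q} {r} m = λ { a → as ; b → bs }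
  where
  A = occurrences a
  B = occurrences b
  ma : (4 * A p + 3 * B p) + (4 * A r + 3 * B r) ≡ 2 * (4 * A q + 3 * B q)
  ma = subst₂ _≡_ (cong₂ _+_ (occurrences-h-a p) (occurrences-h-a r))
                  (cong (2 *_) (occurrences-h-a q)) (m a)
  mb : (A p + 3 * B p) + (A r + 3 * B r) ≡ 2 * (A q + 3 * B q)
  mb = subst₂ _≡_ (cong₂ _+_ (occurrences-h-b p) (occurrences-h-b r))
                  (cong (2 *_) (occurrences-h-b q)) (m b)
  split : ∀ x y x′ y′ →
    3 * (x + x′) + ((x + 3 * y) + (x′ + 3 * y′)) ≡ (4 * x + 3 * y) + (4 * x′ + 3 * y′)
  split = solve-∀
  split₂ : ∀ x y → 2 * (4 * x + 3 * y) ≡ 3 * (2 * x) + 2 * (x + 3 * y)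
  split₂ = solve-∀
  -- For an image, the `a`-count minus the `b`-count is three times the `a`-count of the preimage.
  -- So `ma` minus `mb` is three times the claim.
  as : A p + A r ≡ 2 * A q
  as = *-cancelˡ-≡ (A p + A r) (2 * A q) 3 (+-cancelʳ-≡ (2 * (A q + 3 * B q)) _ _ (begin
    3 * (A p + A r) + 2 * (A q + 3 * B q)
      ≡⟨ cong (3 * (A p + A r) +_) mb ⟨
    3 * (A p + A r) + ((A p + 3 * B p) + (A r + 3 * B r))
      ≡⟨ split (A p) (B p) (A r) (B r) ⟩
    (4 * A p + 3 * B p) + (4 * A r + 3 * B r)
      ≡⟨ ma ⟩
    2 * (4 * A q + 3 * B q)
      ≡⟨ split₂ (A q) (B q) ⟩
    3 * (2 * A q) + 2 * (A q + 3 * B q) ∎))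
  regroup : ∀ x y x′ y′ → (x + x′) + 3 * (y + y′) ≡ (x + 3 * y) + (x′ + 3 * y′)
  regroup = solve-∀
  regroup₂ : ∀ x y → 2 * (x + 3 * y) ≡ 2 * x + 3 * (2 * y)
  regroup₂ = solve-∀
  bs : B p + B r ≡ 2 * B q
  bs = *-cancelˡ-≡ (B p + B r) (2 * B q) 3 (+-cancelˡ-≡ (2 * A q) _ _ (begin
    2 * A q + 3 * (B p + B r)              ≡⟨ cong (_+ 3 * (B p + B r)) as ⟨
    (A p + A r) + 3 * (B p + B r)          ≡⟨ regroup (A p) (B p) (A r) (B r) ⟩
    (A p + 3 * B p) + (A r + 3 * B r)      ≡⟨ mb ⟩
    2 * (A q + 3 * B q)                    ≡⟨ regroup₂ (A q) (B q) ⟩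
    2 * A q + 3 * (2 * B q)                ∎))

-- With one `ρ` for all three words, the same `completion` is appended to each and the same
-- `remainder` cancelled, after which `h` is inverted.
midpoint-root : ∀ {p q r} ρ {x y z} →
  p ++ completion ρ ≡ h x ++ remainder ρ →
  q ++ completion ρ ≡ h y ++ remainder ρ →
  r ++ completion ρ ≡ h z ++ remainder ρ →
  Midpoint p q r → Midpoint x y z
midpoint-root {p} {q} {r} ρ {x} {y} {z} ex ey ez m =
  midpoint-h⁻¹ {x} {y} {z} (midpoint-cancel {h x} {h y} {h z} (remainder ρ) aligned)
  where
  aligned : Midpoint (h x ++ remainder ρ) (h y ++ remainder ρ) (h z ++ remainder ρ)
  aligned rewrite sym ex | sym ey | sym ez = midpoint-++ {p} {q} {r} (completion ρ) m

-- Residues in arithmetic progression.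

-- The term 2y - x following `x` and `y`, with 8 standing for -1 modulo 9.
next : ℕ → ℕ → ℕ
next x y = (2 * y + 8 * x) % 9

residue-next : ∀ p q r → Midpoint p q r → residue r ≡ next (residue p) (residue q)
residue-next p q r m = begin
  R % 9                                   ≡⟨ [m+kn]%n≡m%n R P 9 ⟨
  (R + P * 9) % 9                         ≡⟨ cong (_% 9) equal ⟩
  (2 * (Q % 9) + 8 * (P % 9) + (2 * (Q / 9) + 8 * (P / 9)) * 9) % 9
    ≡⟨ [m+kn]%n≡m%n (2 * (Q % 9) + 8 * (P % 9)) (2 * (Q / 9) + 8 * (P / 9)) 9 ⟩
  (2 * (Q % 9) + 8 * (P % 9)) % 9         ∎
  where
  P = weight 5 p
  Q = weight 5 q
  R = weight 5 r
  shuffle : ∀ R P → R + P * 9 ≡ (P + R) + 8 * P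
  shuffle = solve-∀
  collect : ∀ x k y l → 2 * (x + k * 9) + 8 * (y + l * 9) ≡ 2 * x + 8 * y + (2 * k + 8 * l) * 9
  collect = solve-∀
  equal : R + P * 9 ≡ 2 * (Q % 9) + 8 * (P % 9) + (2 * (Q / 9) + 8 * (P / 9)) * 9
  equal = begin
    R + P * 9         ≡⟨ shuffle R P ⟩
    (P + R) + 8 * P   ≡⟨ cong (_+ 8 * P) (midpoint-weight 5 p q r m) ⟩
    2 * Q + 8 * P     ≡⟨ cong₂ (λ x y → 2 * x + 8 * y) (m≡m%n+[m/n]*n Q 9) (m≡m%n+[m/n]*n P 9) ⟩
    2 * (Q % 9 + Q / 9 * 9) + 8 * (P % 9 + P / 9 * 9)
      ≡⟨ collect (Q % 9) (Q / 9) (P % 9) (P / 9) ⟩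
    2 * (Q % 9) + 8 * (P % 9) + (2 * (Q / 9) + 8 * (P / 9)) * 9 ∎

-- For residues 6 and 7 the completion is empty, and the remainders `ab` and `aba` weigh exactly 6
-- and 7.
weight-inside-b : ∀ p ρ x → InsideB ρ → p ++ completion ρ ≡ h x ++ remainder ρ →
  weight 5 p ≡ weight 2 x * 9 + ρ
weight-inside-b p ρ x (inj₁ refl) e = begin
  weight 5 p                        ≡⟨ cong (weight 5) (trans (sym (++-identityʳ p)) e) ⟩
  weight 5 (h x ++ remainder 6)     ≡⟨ weight-++ 5 (h x) (remainder 6) ⟩
  weight 5 (h x) + 6                ≡⟨ cong (_+ 6) (weight-h x) ⟩
  weight 2 x * 9 + 6                ∎
weight-inside-b p ρ x (inj₂ refl) e = begin
  weight 5 p                        ≡⟨ cong (weight 5) (trans (sym (++-identityʳ p)) e) ⟩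
  weight 5 (h x ++ remainder 7)     ≡⟨ weight-++ 5 (h x) (remainder 7) ⟩
  weight 5 (h x) + 7                ≡⟨ cong (_+ 7) (weight-h x) ⟩
  weight 2 x * 9 + 7                ∎

-- Both root weights are 1 modulo 3, so the weights of `p` and `s` differ by a multiple of 27. That
-- difference is three times the step from `p` to `q`, so the step is a multiple of 9.
residue-inside-b : ∀ p q r s → Root p → Root s → Midpoint p q r → Midpoint q r s →
  InsideB (residue p) → residue s ≡ residue p → residue q ≡ residue p
residue-inside-b p q r s rp rs m m′ inside same = begin
  Q % 9                          ≡⟨ cong (_% 9) Q≡ ⟩
  (ρ + (1 + l + 2 * k) * 9) % 9  ≡⟨ [m+kn]%n≡m%n ρ (1 + l + 2 * k) 9 ⟩
  ρ % 9                          ≡⟨ m%n%n≡m%n (weight 5 p) 9 ⟩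
  ρ                              ∎
  where
  module P = Root rp
  module S = Root rs
  ρ = residue p
  Q = weight 5 q
  R = weight 5 r
  k = weight 2 P.root / 3
  l = weight 2 S.root / 3
  P≡ : weight 5 p ≡ (1 + k * 3) * 9 + ρ
  P≡ = trans (weight-inside-b p ρ P.root inside P.aligned)
    (cong (λ n → n * 9 + ρ) (trans (m≡m%n+[m/n]*n (weight 2 P.root) 3) (cong (_+ k * 3) (P.root-weight inside))))
  S≡ : weight 5 s ≡ (1 + l * 3) * 9 + ρ
  S≡ = trans (weight-inside-b s ρ S.root inside
               (subst (λ x → s ++ completion x ≡ h S.root ++ remainder x) same S.aligned))
    (cong (λ n → n * 9 + ρ) (trans (m≡m%n+[m/n]*n (weight 2 S.root) 3)
      (cong (_+ l * 3) (S.root-weight (subst InsideB (sym same) inside)))))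
  triple : ∀ P Q R S → P + R ≡ 2 * Q → Q + S ≡ 2 * R → S + 2 * P ≡ 3 * Q
  triple P Q R S e e′ = +-cancelˡ-≡ Q _ _ (begin
    Q + (S + 2 * P)   ≡⟨ +-assoc Q S (2 * P) ⟨
    (Q + S) + 2 * P   ≡⟨ cong (_+ 2 * P) e′ ⟩
    2 * R + 2 * P     ≡⟨ *-distribˡ-+ 2 R P ⟨
    2 * (R + P)       ≡⟨ cong (2 *_) (trans (+-comm R P) e) ⟩
    2 * (2 * Q)       ≡⟨ four Q ⟩
    Q + 3 * Q         ∎)
    where four : ∀ Q → 2 * (2 * Q) ≡ Q + 3 * Q
          four = solve-∀
  collect : ∀ k l ρ → ((1 + l * 3) * 9 + ρ) + 2 * ((1 + k * 3) * 9 + ρ) ≡ 3 * (ρ + (1 + l + 2 * k) * 9)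
  collect = solve-∀
  Q≡ : Q ≡ ρ + (1 + l + 2 * k) * 9
  Q≡ = *-cancelˡ-≡ Q _ 3 (begin
    3 * Q                       ≡⟨ triple (weight 5 p) Q R (weight 5 s)
                                     (midpoint-weight 5 p q r m) (midpoint-weight 5 q r s m′) ⟨
    weight 5 s + 2 * weight 5 p ≡⟨ cong₂ (λ x y → x + 2 * y) S≡ P≡ ⟩
    ((1 + l * 3) * 9 + ρ) + 2 * ((1 + k * 3) * 9 + ρ) ≡⟨ collect k l ρ ⟩
    3 * (ρ + (1 + l + 2 * k) * 9) ∎)

progression : ℕ → ℕ → ℕ → ℕ
progression x y zero          = x
progression x y (suc zero)    = y
progression x y (suc (suc i)) = next (progression x y i) (progression x y (suc i))

InsideB? : ∀ r → Dec (InsideB r)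
InsideB? r = (r ℕ.≟ 6) ⊎-dec (r ℕ.≟ 7)

Attained? : ∀ r → Dec (Attained r)
Attained? r = ¬? (r ℕ.≟ 5) ×-dec ¬? (r ℕ.≟ 8)

-- Decided by checking all 81 pairs. If the difference is prime to 3, six terms meet two members of
-- the class 2, 5, 8, hence 5 or 8. If it is 3 or 6, the first three terms fill a class modulo 3:
-- one class contains 5 and 8, and the others contain 6 or 7, where the second hypothesis would
-- force difference 0.
constant-progression : ∀ (x y : Fin 9) → let P = progression (toℕ x) (toℕ y) in
  (∀ (i : Fin 6) → Attained (P (toℕ i))) →
  (∀ (i : Fin 3) → InsideB (P (toℕ i)) → P (3 + toℕ i) ≡ P (toℕ i) → P (1 + toℕ i) ≡ P (toℕ i)) →
  ∀ (i : Fin 6) → P (toℕ i) ≡ toℕ x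
constant-progression = from-yes (all? {n = 9} λ x → all? {n = 9} λ y → let P = progression (toℕ x) (toℕ y) in
  all? (λ (i : Fin 6) → Attained? (P (toℕ i))) →-dec
  (all? (λ (i : Fin 3) → InsideB? (P (toℕ i)) →-dec
    ((P (3 + toℕ i) ℕ.≟ P (toℕ i)) →-dec (P (1 + toℕ i) ℕ.≟ P (toℕ i)))) →-dec
  all? (λ (i : Fin 6) → P (toℕ i) ℕ.≟ toℕ x)))

-- Descent from boundaries to their roots.

-- No order among the six prefixes is demanded, since for the roots it is not known in advance.
record Boundaries (p : Fin 6 → Word) : Set where
  field
    prefix   : ∀ i → p i PrefixOf hω
    midpoint : ∀ (i : Fin 4) →
      Midpoint (p (inject₁ (inject₁ i))) (p (inject₁ (suc i))) (p (suc (suc i)))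

constant-residues : ∀ {p} → Boundaries p → ∀ i → residue (p i) ≡ residue (p 0F)
constant-residues {p} bd i = trans (prog i) (subst₂
    (λ x y → progression x y (toℕ i) ≡ x)
    (toℕ-fromℕ< x<9) (toℕ-fromℕ< y<9)
    (constant-progression (fromℕ< x<9) (fromℕ< y<9) att ins i))
  where
  open Boundaries bd
  r = λ i → residue (p i)
  roots : ∀ i → Root (p i)
  roots i = prefix-root (p i) (prefix i)
  x<9 : r 0F < 9
  x<9 = m%n<n (weight 5 (p 0F)) 9
  y<9 : r 1F < 9
  y<9 = m%n<n (weight 5 (p 1F)) 9
  step : ∀ (i : Fin 4) → r (suc (suc i)) ≡ next (r (inject₁ (inject₁ i))) (r (inject₁ (suc i)))
  step i = residue-next (p (inject₁ (inject₁ i))) (p (inject₁ (suc i))) (p (suc (suc i))) (midpoint i)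
  prog₂ = step 0F
  prog₃ = trans (step 1F) (cong (next (r 1F)) prog₂)
  prog₄ = trans (step 2F) (cong₂ next prog₂ prog₃)
  prog₅ = trans (step 3F) (cong₂ next prog₃ prog₄)
  prog : ∀ i → r i ≡ progression (r 0F) (r 1F) (toℕ i)
  prog 0F = refl
  prog 1F = refl
  prog 2F = prog₂
  prog 3F = prog₃
  prog 4F = prog₄
  prog 5F = prog₅
  -- The finite check is over `Fin 9`, so the two initial residues pass through `fromℕ<` and back.
  prog′ : ∀ i → progression (toℕ (fromℕ< x<9)) (toℕ (fromℕ< y<9)) (toℕ i) ≡ r i
  prog′ i = trans (cong₂ (λ x y → progression x y (toℕ i)) (toℕ-fromℕ< x<9) (toℕ-fromℕ< y<9))
                  (sym (prog i))
  att : ∀ i → Attained (progression (toℕ (fromℕ< x<9)) (toℕ (fromℕ< y<9)) (toℕ i))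
  att i = subst Attained (sym (prog′ i)) (Root.attained (roots i))
  inside : ∀ j₀ j₁ j₂ j₃ → Midpoint (p j₀) (p j₁) (p j₂) → Midpoint (p j₁) (p j₂) (p j₃) →
    let P = λ j → progression (toℕ (fromℕ< x<9)) (toℕ (fromℕ< y<9)) (toℕ j) in
    InsideB (P j₀) → P j₃ ≡ P j₀ → P j₁ ≡ P j₀
  inside j₀ j₁ j₂ j₃ m m′ rewrite prog′ j₀ | prog′ j₁ | prog′ j₃ =
    residue-inside-b (p j₀) (p j₁) (p j₂) (p j₃) (roots j₀) (roots j₃) m m′
  ins : ∀ (i : Fin 3) → let P = progression (toℕ (fromℕ< x<9)) (toℕ (fromℕ< y<9)) in
    InsideB (P (toℕ i)) → P (3 + toℕ i) ≡ P (toℕ i) → P (1 + toℕ i) ≡ P (toℕ i)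
  ins 0F = inside 0F 1F 2F 3F (midpoint 0F) (midpoint 1F)
  ins 1F = inside 1F 2F 3F 4F (midpoint 1F) (midpoint 2F)
  ins 2F = inside 2F 3F 4F 5F (midpoint 2F) (midpoint 3F)

length≡0⇒[] : ∀ (u : Word) → length u ≡ 0 → u ≡ []
length≡0⇒[] [] _ = refl

-- The common corrections `l` and `r` cancel, so the gap between two boundaries is as long as the
-- gap between the images of their roots.
gap-length : ∀ p v (l r : Word) x y → p ++ l ≡ h x ++ r → (p ++ v) ++ l ≡ h y ++ r →
  length (h x) + length v ≡ length (h y)
gap-length p v l r x y ex ey = +-cancelʳ-≡ (length r) _ _ (begin
  length (h x) + length v + length r   ≡⟨ swap (length (h x)) (length v) (length r) ⟩
  length (h x) + length r + length v   ≡⟨ cong (_+ length v) (length-++ (h x)) ⟨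
  length (h x ++ r) + length v         ≡⟨ cong (λ u → length u + length v) ex ⟨
  length (p ++ l) + length v           ≡⟨ cong (_+ length v) (length-++ p) ⟩
  length p + length l + length v       ≡⟨ swap (length p) (length l) (length v) ⟩
  length p + length v + length l       ≡⟨ cong (_+ length l) (length-++ p) ⟨
  length (p ++ v) + length l           ≡⟨ length-++ (p ++ v) ⟨
  length ((p ++ v) ++ l)               ≡⟨ cong length ey ⟩
  length (h y ++ r)                    ≡⟨ length-++ (h y) ⟩
  length (h y) + length r              ∎)
  where swap : ∀ x y z → x + y + z ≡ x + z + y
        swap = solve-∀

length-h-++ : ∀ u v → length (h (u ++ v)) ≡ length (h u) + length (h v)
length-h-++ u v = trans (cong length (concatMap-++ hLetter u v)) (length-++ (h u))

halve-≤ : ∀ m {n} → m + m ≤ suc n → m ≤ n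
halve-≤ zero    _       = z≤n
halve-≤ (suc m) (s≤s q) = ≤-trans (m≤n+m (suc m) m) q

-- Induction on the bound `n`. The roots form boundaries again, and their first gap `t` satisfies
-- 2|t| ≤ |h(t)| = |v| ≤ n + 1, so |t| ≤ n.
no-gap : ∀ n {p} → Boundaries p → ∀ v → p 1F ≡ p 0F ++ v → length v ≤ n → v ≡ []
no-gap zero    bd v e v≤n = length≡0⇒[] v (n≤0⇒n≡0 v≤n)
no-gap (suc n) {p} bd v e v≤n = conclude
  (compare-prefixes (root 0F) (root 1F) (Boundaries.prefix roots 0F) (Boundaries.prefix roots 1F))
  where
  open Boundaries bd
  root : Fin 6 → Word
  root i = Root.root (prefix-root (p i) (prefix i))
  ρ = residue (p 0F)
  -- Constancy of the residues allows a single `ρ` for all six boundaries.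
  aligned : ∀ i → p i ++ completion ρ ≡ h (root i) ++ remainder ρ
  aligned i = subst (λ x → p i ++ completion x ≡ h (root i) ++ remainder x)
    (constant-residues bd i) (Root.aligned (prefix-root (p i) (prefix i)))
  roots : Boundaries root
  roots = record
    { prefix   = λ i → Root.root-prefix (prefix-root (p i) (prefix i))
    ; midpoint = λ i → midpoint-root ρ
        {root (inject₁ (inject₁ i))} {root (inject₁ (suc i))} {root (suc (suc i))}
        (aligned _) (aligned _) (aligned _) (midpoint i)
    }
  gap : length (h (root 0F)) + length v ≡ length (h (root 1F))
  gap = gap-length (p 0F) v (completion ρ) (remainder ρ) (root 0F) (root 1F)
    (aligned 0F) (subst (λ u → u ++ completion ρ ≡ h (root 1F) ++ remainder ρ) e (aligned 1F))
  conclude : (∃[ t ] root 1F ≡ root 0F ++ t) ⊎ (∃[ t ] root 0F ≡ root 1F ++ t) → v ≡ []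
  conclude (inj₁ (t , eq)) = length≡0⇒[] v (trans |v|≡|ht| (cong (λ u → length (h u)) t≡[]))
    where
    |v|≡|ht| : length v ≡ length (h t)
    |v|≡|ht| = +-cancelˡ-≡ (length (h (root 0F))) _ _
      (trans gap (trans (cong (λ u → length (h u)) eq) (length-h-++ (root 0F) t)))
    t≡[] : t ≡ []
    t≡[] = no-gap n roots t eq
      (halve-≤ (length t) (≤-trans (length-h t) (subst (_≤ suc n) |v|≡|ht| v≤n)))
  -- If the second root is the shorter one, the lengths force |h(t)| + |v| = 0.
  conclude (inj₂ (t , eq)) = length≡0⇒[] v (m+n≡0⇒n≡0 (length (h t)) (+-cancelˡ-≡ (length (h (root 1F))) _ _ (begin
    length (h (root 1F)) + (length (h t) + length v) ≡⟨ +-assoc (length (h (root 1F))) _ _ ⟨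
    length (h (root 1F)) + length (h t) + length v   ≡⟨ cong (_+ length v) (length-h-++ (root 1F) t) ⟨
    length (h (root 1F ++ t)) + length v             ≡⟨ cong (λ u → length (h u) + length v) eq ⟨
    length (h (root 0F)) + length v                  ≡⟨ gap ⟩
    length (h (root 1F))                             ≡⟨ +-identityʳ _ ⟨
    length (h (root 1F)) + 0                         ∎)))

-- Boundaries of an abelian 5th power in `hω`.

ψ-occurrences : ∀ u v → ψ u ≡ ψ v → ∀ c → occurrences c u ≡ occurrences c v
ψ-occurrences u v e a = cong Vec.head e
ψ-occurrences u v e b = cong (λ x → Vec.head (Vec.tail x)) e

ψ-length : ∀ u v → ψ u ≡ ψ v → length u ≡ length v
ψ-length u v e = begin
  length u                        ≡⟨ length-occurrences u ⟩
  occurrences a u + occurrences b u ≡⟨ cong₂ _+_ (ψ-occurrences u v e a) (ψ-occurrences u v e b) ⟩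
  occurrences a v + occurrences b v ≡⟨ length-occurrences v ⟨
  length v                        ∎

midpoint-abelian : ∀ p u v → ψ u ≡ ψ v → Midpoint p (p ++ u) ((p ++ u) ++ v)
midpoint-abelian p u v e c
  rewrite occurrences-++ c (p ++ u) v | occurrences-++ c p u | ψ-occurrences u v e c =
  lemma (occurrences c p) (occurrences c v)
  where lemma : ∀ x y → x + (x + y + y) ≡ 2 * (x + y)
        lemma = solve-∀

hω-power-free : AbelianPowerFreeω 5 hω
hω-power-free x vs@(v₁ ∷ v₂ ∷ v₃ ∷ v₄ ∷ v₅ ∷ []) y eq ab i =
  -- All blocks have the length of `v₁`, so only the first gap has to be shown empty.
  length≡0⇒[] (Vec.lookup vs i) (trans (ψ-length (Vec.lookup vs i) v₁ (ab i 0F)) (cong length v₁≡[]))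
  where
  p₁ p₂ p₃ p₄ p₅ : Word
  p₁ = x  ++ v₁
  p₂ = p₁ ++ v₂
  p₃ = p₂ ++ v₃
  p₄ = p₃ ++ v₄
  p₅ = p₄ ++ v₅
  assoc : x ++ concat (toList vs) ≡ p₅
  assoc = begin
    x ++ v₁ ++ v₂ ++ v₃ ++ v₄ ++ v₅ ++ []  ≡⟨ ++-assoc x v₁ _ ⟨
    p₁ ++ v₂ ++ v₃ ++ v₄ ++ v₅ ++ []       ≡⟨ ++-assoc p₁ v₂ _ ⟨
    p₂ ++ v₃ ++ v₄ ++ v₅ ++ []             ≡⟨ ++-assoc p₂ v₃ _ ⟨
    p₃ ++ v₄ ++ v₅ ++ []                   ≡⟨ ++-assoc p₃ v₄ _ ⟨
    p₄ ++ v₅ ++ []                         ≡⟨ cong (p₄ ++_) (++-identityʳ v₅) ⟩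
    p₅                                     ∎
  p : Fin 6 → Word
  p = Vec.lookup (x ∷ p₁ ∷ p₂ ∷ p₃ ∷ p₄ ∷ p₅ ∷ [])
  pre₅ : p₅ PrefixOf hω
  pre₅ = subst (_PrefixOf hω) assoc (y , eq)
  pre₄ : p₄ PrefixOf hω
  pre₄ = prefix-++ˡ p₄ v₅ pre₅
  pre₃ : p₃ PrefixOf hω
  pre₃ = prefix-++ˡ p₃ v₄ pre₄
  pre₂ : p₂ PrefixOf hω
  pre₂ = prefix-++ˡ p₂ v₃ pre₃
  pre₁ : p₁ PrefixOf hω
  pre₁ = prefix-++ˡ p₁ v₂ pre₂
  boundaries : Boundaries p
  boundaries = record
    { prefix   = λ { 0F → prefix-++ˡ x v₁ pre₁ ; 1F → pre₁ ; 2F → pre₂ ; 3F → pre₃ ; 4F → pre₄ ; 5F → pre₅ }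
    ; midpoint = λ { 0F → midpoint-abelian x  v₁ v₂ (ab 0F 1F)
                   ; 1F → midpoint-abelian p₁ v₂ v₃ (ab 1F 2F)
                   ; 2F → midpoint-abelian p₂ v₃ v₄ (ab 2F 3F)
                   ; 3F → midpoint-abelian p₃ v₄ v₅ (ab 3F 4F) }
    }
  v₁≡[] : v₁ ≡ []
  v₁≡[] = no-gap (length v₁) boundaries v₁ refl ≤-refl

-- Failure of power freeness for the morphism.

length-concat : ∀ {k} (vs : Vec Word k) l → (∀ i → length (Vec.lookup vs i) ≡ l) →
  length (concat (toList vs)) ≡ k * l
length-concat []       l eq = refl
length-concat (v ∷ vs) l eq =
  trans (length-++ v) (cong₂ _+_ (eq 0F) (length-concat vs l (λ i → eq (suc i))))

-- If one block is nonempty, all `k` blocks share its positive length and occupy at least `k`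
-- letters.
short-power-free : ∀ k u → length u < k → AbelianPowerFree k u
short-power-free k u u<k x vs y eq ab i with Vec.lookup vs i in e
... | []    = refl
... | c ∷ v = contradiction k≤u (<⇒≱ u<k)
  where
  l = suc (length v)
  k≤u : k ≤ length u
  k≤u = ≤-trans (m≤m*n k l)
    (≤-trans (≤-reflexive (sym (length-concat vs l λ j →
      trans (ψ-length (Vec.lookup vs j) (Vec.lookup vs i) (ab j i)) (cong length e))))
    (≤-trans (length-++-≤ˡ (concat (toList vs)))
    (≤-trans (length-++-≤ʳ (concat (toList vs) ++ y) {xs = x})
             (≤-reflexive (cong length (sym eq))))))

h-replicate-b : ∀ m → h (replicate m b) ≡ concat (replicate (m * 3) (a ∷ b ∷ []))
h-replicate-b zero    = refl
h-replicate-b (suc m) = cong (h [ b ] ++_) (h-replicate-b m)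

concat-replicate-+ : ∀ m n (u : Word) →
  concat (replicate (m + n) u) ≡ concat (replicate m u) ++ concat (replicate n u)
concat-replicate-+ zero    n u = refl
concat-replicate-+ (suc m) n u =
  trans (cong (u ++_) (concat-replicate-+ m n u)) (sym (++-assoc u _ _))

h-not-power-free : ∀ k → 2 ≤ k → ¬ AbelianPowerFreeMorphism k h
h-not-power-free (suc (suc n)) (s≤s (s≤s z≤n)) free =
  contradiction (free u u-free [] vs (concat (replicate (1 + 2 * n) ab)) factorisation equal 0F) λ ()
  where
  ab : Word
  ab = a ∷ b ∷ []
  u : Word
  u = replicate (suc n) b
  vs : Vec Word (suc (suc n))
  vs = Vec.replicate (suc (suc n)) ab
  u-free : AbelianPowerFree (suc (suc n)) u
  u-free = short-power-free _ u (s≤s (≤-reflexive (length-replicate (suc n))))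
  -- Here k = n + 2: of the 3(k - 1) copies of `ab` in `h u`, the first k form the power and 2k - 3
  -- = 1 + 2n remain.
  count : ∀ n → suc n * 3 ≡ suc (suc n) + (1 + 2 * n)
  count = solve-∀
  factorisation : h u ≡ concat (toList vs) ++ concat (replicate (1 + 2 * n) ab)
  factorisation = begin
    h u                                            ≡⟨ h-replicate-b (suc n) ⟩
    concat (replicate (suc n * 3) ab)              ≡⟨ cong (λ m → concat (replicate m ab)) (count n) ⟩
    concat (replicate (suc (suc n) + (1 + 2 * n)) ab)
      ≡⟨ concat-replicate-+ (suc (suc n)) (1 + 2 * n) ab ⟩
    concat (replicate (suc (suc n)) ab) ++ concat (replicate (1 + 2 * n) ab)
      ≡⟨ cong (λ xs → concat xs ++ concat (replicate (1 + 2 * n) ab)) (Vec.toList-replicate (suc (suc n)) ab) ⟨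
    concat (toList vs) ++ concat (replicate (1 + 2 * n) ab) ∎
  equal : AbelianEqual vs
  equal i j = cong ψ (trans (Vec.lookup-replicate i ab) (sym (Vec.lookup-replicate j ab)))

theorem5p1 : AbelianPowerFreeω 5 hω
    × ¬ ((b ∷ b ∷ []) FactorOf hω)
    × (∀ (k : ℕ) → 2 ≤ k → ¬ AbelianPowerFreeMorphism k h)
theorem5p1 = hω-power-free , no-bb , h-not-power-free
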